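{- Let $n$ be a nonnegative integer, and let $A$ be a square matrix of size $n$ (with entries in a commutative ring containing $\lambda$). Then $$\operatorname{Pf}_\lambda\begin{pmatrix}O_n&A\\-A^T&O_n\end{pmatrix}=(-\lambda)^{n(n-1)/2}\det A,$$ where $O_n$ is the zero matrix of size $n$ and $A^T$ is the transpose of $A$.
   Context: For a skew-symmetric matrix $B$ of size $2n$, the $\lambda$-Pfaffian is $$\operatorname{Pf}_\lambda(B)=\sum_{m\in\mathcal M([2n])}(-1)^{\mathrm{cross}(m)}\,\lambda^{\mathrm{cross}(m)+\mathrm{nest}(m)}\prod_{i=1}^n B_{m_{2i-1}m_{2i}},$$ with $\operatorname{Pf}_\lambda$ of the empty matrix equal to $1$. Here $\mathcal M([2n])$ is the set of perfect matchings of $[2n]=\{1,\dots,2n\}$, written $m=((m_1,m_2),\dots,(m_{2n-1},m_{2n}))$ with $m_{2i-1}<m_{2i}$ for all $i$ and $m_1<m_3<\cdots<m_{2n-1}$. $\mathrm{cross}(m)$ is the number of (unordered) pairs of pairs $(a,b),(c,d)$ in $m$ with $a<c<b<d$; $\mathrm{nest}(m)$ is the number of pairs of pairs $(a,b),(c,d)$ in $m$ with $a<c<d<b$. -}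

module Defs where

open import Algebra.Bundles using (CommutativeRing)
import Algebra.Definitions.RawMonoid as RawMonoidDefs
import Algebra.Properties.Ring as RingProperties
import Algebra.Properties.Semiring.Exp as Exp
open import Data.Fin.Base using (Fin; _<_; splitAt)
open import Data.Fin.Properties using (_≟_; _<?_; all?; any?)
open import Data.List.Base as List using (List; allFin; cartesianProduct; cartesianProductWith; filter)
open import Data.Nat.Base as ℕ using (ℕ; zero; suc)
open import Data.Product.Base using (_×_; _,_; proj₁; proj₂)
open import Data.Sum.Base using (inj₁; inj₂)
open import Data.Vec.Base as Vec using (Vec; []; _∷_; lookup)
import Data.Vec.Functional as F
open import Function.Definitions using (Injective; Surjective; Bijective)
open import Level using (Level)
open import Relation.Binary.Core using (REL)
import Relation.Binary.Definitions as B
open import Relation.Binary.PropositionalEquality.Core using (_≡_; refl)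
open import Relation.Nullary.Decidable using (Dec; map′; _×-dec_; _→-dec_)

private
  variable
    a p : Level

-- [n] = {1,…,n} is rendered by Fin n throughout.

allVecs : {A : Set a} → List A → (n : ℕ) → List (Vec A n)
allVecs xs zero    = List.[ [] ]
allVecs xs (suc n) = cartesianProductWith _∷_ xs (allVecs xs n)

countPairs : (n : ℕ) {P : REL (Fin n) (Fin n) p} → B.Decidable P → ℕ
countPairs n P? =
  List.length (filter (λ ij → P? (proj₁ ij) (proj₂ ij)) (cartesianProduct (allFin n) (allFin n)))

-- v, read as the function i ↦ lookup v i, is a bijection.
IsBijection : ∀ {m n} → Vec (Fin n) m → Set
IsBijection v = Bijective _≡_ _≡_ (lookup v)

isBijection? : ∀ {m n} (v : Vec (Fin n) m) → Dec (IsBijection v)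
isBijection? v = injective? ×-dec surjective?
  where
  injective? : Dec (Injective _≡_ _≡_ (lookup v))
  injective? = map′ (λ h {i} {j} → h i j) (λ h i j → h)
    (all? λ i → all? λ j → (lookup v i ≟ lookup v j) →-dec (i ≟ j))

  surjective? : Dec (Surjective _≡_ _≡_ (lookup v))
  surjective? = all? λ y → any? λ x →
    map′ (λ eq → λ { refl → eq }) (λ h → h refl) (lookup v x ≟ y)

-- One-line notation: lookup σ i is the image of i.
permutations : (n : ℕ) → List (Vec (Fin n) n)
permutations n = filter isBijection? (allVecs (allFin n) n)

inversions : ∀ {n} → Vec (Fin n) n → ℕ
inversions {n} σ = countPairs n λ i j → (i <? j) ×-dec (lookup σ j <? lookup σ i)

-- A list of n pairs of elements of [N]; entry i is the pair (m_{2i-1}, m_{2i}).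
Pairs : ℕ → ℕ → Set
Pairs N n = Vec (Fin N × Fin N) n

module _ {N n : ℕ} (m : Pairs N n) where

  fst snd : Fin n → Fin N
  fst i = proj₁ (lookup m i)
  snd i = proj₂ (lookup m i)

  entries : Vec (Fin N) (n ℕ.+ n)
  entries = Vec.map proj₁ m Vec.++ Vec.map proj₂ m

  record IsPerfectMatching : Set where
    field
      ordered   : ∀ i → fst i < snd i
      sorted    : ∀ i j → i < j → fst i < fst j
      -- every element of [N] occurs in exactly one position of the pairs
      partition : IsBijection entries

  isPerfectMatching? : Dec IsPerfectMatching
  isPerfectMatching? = map′
    (λ { (o , s , b) → record { ordered = o ; sorted = s ; partition = b } })
    (λ M → let open IsPerfectMatching M in ordered , sorted , partition)
    (all? (λ i → fst i <? snd i)
      ×-dec all? (λ i → all? λ j → (i <? j) →-dec (fst i <? fst j))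
      ×-dec isBijection? entries)

  -- All (i , j) are inspected, but a < c can hold for only one of the two
  -- orderings of an unordered pair of pairs, so each is counted at most once.
  cross nest : ℕ
  cross = countPairs n λ i j →
    (fst i <? fst j) ×-dec (fst j <? snd i) ×-dec (snd i <? snd j)
  nest  = countPairs n λ i j →
    (fst i <? fst j) ×-dec (fst j <? snd j) ×-dec (snd j <? snd i)

perfectMatchings : (n : ℕ) → List (Pairs (n ℕ.+ n) n)
perfectMatchings n =
  filter isPerfectMatching? (allVecs (cartesianProduct (allFin N) (allFin N)) n)
  where N = n ℕ.+ n

module _ {c ℓ} (R : CommutativeRing c ℓ) where

  open CommutativeRing R renaming (refl to ≈-refl)
  open Exp semiring using (_^_)
  open RingProperties ring using (-0#≈0#; -‿involutive)

  Matrix : ℕ → ℕ → Set c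
  Matrix m n = F.Vector (F.Vector Carrier n) m

  ∑ : {A : Set a} → List A → (A → Carrier) → Carrier
  ∑ xs f = List.foldr _+_ 0# (List.map f xs)

  ∏ : ∀ {n} → F.Vector Carrier n → Carrier
  ∏ = RawMonoidDefs.sum *-rawMonoid

  det : (n : ℕ) → Matrix n n → Carrier
  det n A = ∑ (permutations n) λ σ →
    (- 1#) ^ inversions σ * ∏ λ i → A i (lookup σ i)

  -- The formula makes sense for any matrix of size 2n; it reads only the
  -- entries above the diagonal, which determine a skew-symmetric matrix with zero diagonal.
  Pf : Carrier → (n : ℕ) → Matrix (n ℕ.+ n) (n ℕ.+ n) → Carrier
  Pf lam n B = ∑ (perfectMatchings n) λ m →
    (- 1#) ^ cross m * lam ^ (cross m ℕ.+ nest m) * ∏ λ i → B (fst m i) (snd m i)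

  O : (n : ℕ) → Matrix n n
  O n i j = 0#

  neg : ∀ {m n} → Matrix m n → Matrix m n
  neg A i j = - A i j

  blockMatrix : ∀ {m n k l} → Matrix m k → Matrix m l → Matrix n k → Matrix n l →
                Matrix (m ℕ.+ n) (k ℕ.+ l)
  blockMatrix P Q S T = F.zipWith F._++_ P Q F.++ F.zipWith F._++_ S T

  skewBlock : (n : ℕ) → Matrix n n → Matrix (n ℕ.+ n) (n ℕ.+ n)
  skewBlock n A = blockMatrix (O n) A (neg (F.transpose A)) (O n)

  SkewSymmetric : ∀ {n} → Matrix n n → Set ℓ
  SkewSymmetric B = ∀ i j → B j i ≈ - B i j

  skewBlock-skewSymmetric : ∀ n (A : Matrix n n) → SkewSymmetric (skewBlock n A)
  skewBlock-skewSymmetric n A i j with splitAt n i in p | splitAt n j in q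
  ... | inj₁ _ | inj₁ _ rewrite p | q = sym -0#≈0#
  ... | inj₁ _ | inj₂ _ rewrite p | q = ≈-refl
  ... | inj₂ _ | inj₁ _ rewrite p | q = sym (-‿involutive _)
  ... | inj₂ _ | inj₂ _ rewrite p | q = sym -0#≈0#

  skewBlock-diagonal : ∀ n (A : Matrix n n) i → skewBlock n A i i ≈ 0#
  skewBlock-diagonal n A i with splitAt n i in p
  ... | inj₁ _ rewrite p = ≈-refl
  ... | inj₂ _ rewrite p = ≈-refl

  Pf-empty : ∀ lam B → Pf lam 0 B ≈ 1#
  Pf-empty lam B = trans (+-identityʳ _) (trans (*-identityʳ _) (*-identityʳ _))

{-# OPTIONS --safe #-}
module Submission where

-- Above the diagonal, the skew block matrix is nonzero only at entries joining
-- the left half of [2n] to the right half, so only matchings all of whose pairs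
-- go across contribute. As first components increase, such a matching is
-- {(i , n + σ i)} for a permutation σ. For i < j the pairs of i and j then cross
-- if σ i < σ j and nest if σ i > σ j, whence nest = inv σ and
-- cross + nest = n(n−1)/2, and (−1)^cross = (−1)^(cross + nest) (−1)^(inv σ).

open import Defs
open import Algebra.Bundles using (CommutativeRing)
import Algebra.Properties.CommutativeSemiring.Exp as CommutativeExp
import Algebra.Properties.Monoid.Sum as MonoidSum
import Algebra.Properties.Ring as RingProperties
import Algebra.Properties.Semiring.Exp as Exp
open import Data.Fin.Base using (Fin; zero; suc; toℕ; splitAt; _<_; _↑ˡ_; _↑ʳ_)
open import Data.Fin.Properties
  using (_≟_; _<?_; <-cmp; <⇒≢; toℕ<n; toℕ-injective; toℕ-↑ˡ; toℕ-↑ʳ;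
         ↑ʳ-injective; splitAt-↑ˡ; splitAt-↑ʳ; splitAt⁻¹-↑ˡ; splitAt⁻¹-↑ʳ)
open import Data.List.Base
  using (List; []; _∷_; _++_; map; filter; length; allFin; cartesianProduct)
open import Data.List.Membership.DecPropositional using (_∈?_)
open import Data.List.Membership.Propositional using (_∈_; _∉_)
open import Data.List.Membership.Propositional.Properties
  using (∈-map⁺; ∈-map⁻; ∈-filter⁺; ∈-filter⁻; ∈-allFin;
         ∈-cartesianProduct⁺; ∈-cartesianProductWith⁺)
open import Data.List.Membership.Propositional.Properties.WithK using (unique∧set⇒bag)
open import Data.List.Properties
  using (map-∘; map-cong; map-tabulate; length-++; length-tabulate;
         filter-++; filter-≐; filter-all)
open import Data.List.Relation.Binary.BagAndSetEquality using (∼bag⇒↭)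
open import Data.List.Relation.Binary.Permutation.Propositional using (_↭_; ↭⇒↭ₛ′)
open import Data.List.Relation.Binary.Permutation.Propositional.Properties using (map⁺)
import Data.List.Relation.Binary.Permutation.Setoid.Properties as PermutationProperties
open import Data.List.Relation.Binary.Subset.Propositional using (_⊆_)
open import Data.List.Relation.Unary.All using (universal; [])
open import Data.List.Relation.Unary.Any using (here; there)
open import Data.List.Relation.Unary.Unique.Propositional using (Unique; []; _∷_)
import Data.List.Relation.Unary.Unique.Propositional.Properties as Unique
open import Data.Nat.Base as ℕ using (ℕ; zero; suc; z<s; s<s; s<s⁻¹)
open import Data.Nat.DivMod using (_/_; m*n/n≡m)
open import Data.Nat.ListAction using (sum)
import Data.Nat.Properties as ℕ
open import Data.Product.Base using (_×_; _,_; ∃; ∃₂; proj₁; proj₂)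
import Data.Product.Properties as Product
open import Data.Sum.Base using (_⊎_; inj₁; inj₂; [_,_])
open import Data.Vec.Base as Vec using (Vec; []; _∷_; lookup; tabulate)
import Data.Vec.Functional as F
import Data.Vec.Properties as Vec
open import Function.Base using (_∘_; id)
open import Function.Bundles using (mk⇔)
open import Level using (Level)
open import Relation.Binary.Definitions using (DecidableEquality; tri<; tri≈; tri>)
open import Relation.Binary.PropositionalEquality as ≡ using (_≡_; refl; cong; cong₂; subst; subst₂)
import Relation.Binary.Reasoning.Setoid as SetoidReasoning
open import Relation.Nullary using (¬_; yes; no; contradiction)
open import Relation.Unary using (Pred; Decidable)

private
  variable
    a b p q r : Level
    A : Set a
    B : Set b
    n : ℕ

-- A choice among finitely many alternatives, none of which has to be decidable. In `term-vanishes`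
-- it yields either a matching all of whose pairs go across or one pair with a zero entry.
∀⊎∃ : {P : Pred (Fin n) p} {Q : Pred (Fin n) q} →
  (∀ i → P i ⊎ Q i) → (∀ i → P i) ⊎ (∃ λ i → Q i)
∀⊎∃ {zero}  h = inj₁ λ ()
∀⊎∃ {suc n} h with h zero | ∀⊎∃ (h ∘ suc)
... | inj₂ q | _            = inj₂ (zero , q)
... | inj₁ p | inj₂ (i , q) = inj₂ (suc i , q)
... | inj₁ p | inj₁ ps      = inj₁ λ { zero → p ; (suc i) → ps i }

-- Without repetition every multiplicity is 0 or 1, so equal sets are equal bags. Sums over the two
-- lists can then be exchanged.
unique-set⇒↭ : {xs ys : List A} → Unique xs → Unique ys → xs ⊆ ys → ys ⊆ xs → xs ↭ ys
unique-set⇒↭ xs! ys! xs⊆ys ys⊆xs = ∼bag⇒↭ (unique∧set⇒bag xs! ys! (mk⇔ xs⊆ys ys⊆xs))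

-- Enumerations of permutations and perfect matchings

allVecs-unique : {xs : List A} → Unique xs → ∀ n → Unique (allVecs xs n)
allVecs-unique xs! zero    = [] ∷ []
allVecs-unique xs! (suc n) =
  Unique.cartesianProductWith⁺ _∷_ Vec.∷-injective xs! (allVecs-unique xs! n)

∈-allVecs : {xs : List A} → (∀ x → x ∈ xs) → (v : Vec A n) → v ∈ allVecs xs n
∈-allVecs ∈xs []      = here refl
∈-allVecs ∈xs (x ∷ v) = ∈-cartesianProductWith⁺ _∷_ (∈xs x) (∈-allVecs ∈xs v)

permutations-unique : ∀ n → Unique (permutations n)
permutations-unique n = Unique.filter⁺ isBijection? (allVecs-unique (Unique.allFin⁺ n) n)

∈-permutations⁺ : (σ : Vec (Fin n) n) → IsBijection σ → σ ∈ permutations n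
∈-permutations⁺ {n} σ bij = ∈-filter⁺ isBijection? (∈-allVecs ∈-allFin σ) bij

∈-permutations⁻ : (σ : Vec (Fin n) n) → σ ∈ permutations n → IsBijection σ
∈-permutations⁻ {n} σ σ∈ = proj₂ (∈-filter⁻ isBijection? {xs = allVecs (allFin n) n} σ∈)

perfectMatchings-unique : ∀ n → Unique (perfectMatchings n)
perfectMatchings-unique n = Unique.filter⁺ isPerfectMatching?
  (allVecs-unique (Unique.cartesianProduct⁺ (Unique.allFin⁺ _) (Unique.allFin⁺ _)) n)

∈-perfectMatchings⁺ : {m : Pairs (n ℕ.+ n) n} → IsPerfectMatching m → m ∈ perfectMatchings n
∈-perfectMatchings⁺ {n} {m} M = ∈-filter⁺ isPerfectMatching?
  (∈-allVecs (λ _ → ∈-cartesianProduct⁺ (∈-allFin _) (∈-allFin _)) m) M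

∈-perfectMatchings⁻ : {m : Pairs (n ℕ.+ n) n} → m ∈ perfectMatchings n → IsPerfectMatching m
∈-perfectMatchings⁻ {n} m∈ = proj₂ (∈-filter⁻ isPerfectMatching?
  {xs = allVecs (cartesianProduct (allFin (n ℕ.+ n)) (allFin (n ℕ.+ n))) n} m∈)

-- Counting

module _ {P : Pred A p} {Q : Pred A q} {R : Pred A r}
         (P? : Decidable P) (Q? : Decidable Q) (R? : Decidable R) where

  -- Each entry of the list adds one to both sides or nothing to either, because `P` and `Q` split
  -- `R` into disjoint parts. It is applied to crossings and nestings inside the pairs with i < j.
  length-filter-⊎ : (∀ {x} → P x → R x) → (∀ {x} → Q x → R x) →
    (∀ {x} → R x → P x ⊎ Q x) → (∀ {x} → P x → ¬ Q x) →
    ∀ xs → length (filter P? xs) ℕ.+ length (filter Q? xs) ≡ length (filter R? xs)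
  length-filter-⊎ P⊆R Q⊆R R⊆P∪Q disjoint = go
    where
    go : ∀ xs → length (filter P? xs) ℕ.+ length (filter Q? xs) ≡ length (filter R? xs)
    go [] = refl
    go (x ∷ xs) with P? x | Q? x | R? x
    ... | yes p | yes q | _      = contradiction q (disjoint p)
    ... | yes p | no  _ | yes _  = cong suc (go xs)
    ... | no  _ | yes q | yes _  = ≡.trans (ℕ.+-suc _ _) (cong suc (go xs))
    ... | no  _ | no  _ | no  _  = go xs
    ... | yes p | no  _ | no  ¬r = contradiction (P⊆R p) ¬r
    ... | no  _ | yes q | no  ¬r = contradiction (Q⊆R q) ¬r
    ... | no ¬p | no ¬q | yes r  = contradiction (R⊆P∪Q r) [ ¬p , ¬q ]

module _ {P : Pred B p} (P? : Decidable P) where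

  length-filter-map : (f : A → B) → ∀ xs →
    length (filter P? (map f xs)) ≡ length (filter (P? ∘ f) xs)
  length-filter-map f [] = refl
  length-filter-map f (x ∷ xs) with P? (f x)
  ... | yes _ = cong suc (length-filter-map f xs)
  ... | no  _ = length-filter-map f xs

length-filter-cartesianProduct : {P : Pred (A × B) p} (P? : Decidable P) → ∀ xs ys →
  length (filter P? (cartesianProduct xs ys)) ≡ sum (map (λ x → length (filter (P? ∘ (x ,_)) ys)) xs)
length-filter-cartesianProduct P? []       ys = refl
length-filter-cartesianProduct P? (x ∷ xs) ys = begin
  length (filter P? (map (x ,_) ys ++ cartesianProduct xs ys))
    ≡⟨ cong length (filter-++ P? (map (x ,_) ys) _) ⟩
  length (filter P? (map (x ,_) ys) ++ filter P? (cartesianProduct xs ys))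
    ≡⟨ length-++ (filter P? (map (x ,_) ys)) ⟩
  length (filter P? (map (x ,_) ys)) ℕ.+ length (filter P? (cartesianProduct xs ys))
    ≡⟨ cong₂ ℕ._+_ (length-filter-map P? (x ,_) ys) (length-filter-cartesianProduct P? xs ys) ⟩
  sum (map (λ x → length (filter (P? ∘ (x ,_)) ys)) (x ∷ xs)) ∎
  where open ≡.≡-Reasoning

allFin-suc : ∀ n → allFin (suc n) ≡ zero ∷ map suc (allFin n)
allFin-suc n = cong (zero ∷_) (≡.sym (map-tabulate id suc))

-- The row lengths of the strict upper triangle, for counting the pairs i < j row by row.
countAbove : Fin n → ℕ
countAbove {n} i = length (filter (i <?_) (allFin n))

countAbove-zero : ∀ n → countAbove (zero {n}) ≡ n
countAbove-zero n = begin
  countAbove (zero {n})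
    ≡⟨ cong (length ∘ filter (zero {n} <?_)) (allFin-suc n) ⟩
  -- The head `zero` drops out by evaluation, since nothing lies below it; the same happens in
  -- `countAbove-suc`.
  length (filter (zero {n} <?_) (map suc (allFin n)))
    ≡⟨ length-filter-map (zero {n} <?_) suc (allFin n) ⟩
  length (filter (λ j → zero {n} <? suc j) (allFin n))
    ≡⟨ cong length (filter-all (λ j → zero {n} <? suc j) (universal (λ _ → z<s) (allFin n))) ⟩
  length (allFin n)
    ≡⟨ length-tabulate id ⟩
  n ∎
  where open ≡.≡-Reasoning

countAbove-suc : (i : Fin n) → countAbove (suc i) ≡ countAbove i
countAbove-suc {n} i = begin
  countAbove (suc i)
    ≡⟨ cong (length ∘ filter (suc i <?_)) (allFin-suc n) ⟩
  length (filter (suc i <?_) (map suc (allFin n)))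
    ≡⟨ length-filter-map (suc i <?_) suc (allFin n) ⟩
  length (filter (λ j → suc i <? suc j) (allFin n))
    ≡⟨ cong length (filter-≐ _ (i <?_) (s<s⁻¹ , s<s) (allFin n)) ⟩
  countAbove i ∎
  where open ≡.≡-Reasoning

countPairs-<-rows : ∀ n → countPairs n _<?_ ≡ sum (map countAbove (allFin n))
countPairs-<-rows n =
  length-filter-cartesianProduct (λ ij → proj₁ ij <? proj₂ ij) (allFin n) (allFin n)

-- The row of `zero` has n entries, and the remaining rows are those of the triangle of size n
-- shifted by one.
countPairs-<-suc : ∀ n → countPairs (suc n) _<?_ ≡ n ℕ.+ countPairs n _<?_
countPairs-<-suc n = begin
  countPairs (suc n) _<?_
    ≡⟨ countPairs-<-rows (suc n) ⟩
  sum (map countAbove (allFin (suc n)))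
    ≡⟨ cong (sum ∘ map countAbove) (allFin-suc n) ⟩
  countAbove (zero {n}) ℕ.+ sum (map countAbove (map suc (allFin n)))
    ≡⟨ cong (λ xs → countAbove (zero {n}) ℕ.+ sum xs) (map-∘ (allFin n)) ⟨
  countAbove (zero {n}) ℕ.+ sum (map (countAbove ∘ suc) (allFin n))
    ≡⟨ cong₂ ℕ._+_ (countAbove-zero n) (cong sum (map-cong countAbove-suc (allFin n))) ⟩
  n ℕ.+ sum (map countAbove (allFin n))
    ≡⟨ cong (n ℕ.+_) (countPairs-<-rows n) ⟨
  n ℕ.+ countPairs n _<?_ ∎
  where open ≡.≡-Reasoning

-- Doubling keeps the rounding division out of the induction. Matching on two successors lets the
-- truncated `n ∸ 1` of the induction hypothesis reduce.
countPairs-<-*2 : ∀ n → countPairs n _<?_ ℕ.* 2 ≡ n ℕ.* (n ℕ.∸ 1)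
countPairs-<-*2 zero          = refl
countPairs-<-*2 (suc zero)    = refl
countPairs-<-*2 (suc (suc n)) = begin
  countPairs (suc (suc n)) _<?_ ℕ.* 2
    ≡⟨ cong (ℕ._* 2) (countPairs-<-suc (suc n)) ⟩
  (suc n ℕ.+ countPairs (suc n) _<?_) ℕ.* 2
    ≡⟨ ℕ.*-distribʳ-+ 2 (suc n) _ ⟩
  suc n ℕ.* 2 ℕ.+ countPairs (suc n) _<?_ ℕ.* 2
    ≡⟨ cong (suc n ℕ.* 2 ℕ.+_) (countPairs-<-*2 (suc n)) ⟩
  suc n ℕ.* 2 ℕ.+ suc n ℕ.* n
    ≡⟨ ℕ.*-distribˡ-+ (suc n) 2 n ⟨
  suc n ℕ.* suc (suc n)
    ≡⟨ ℕ.*-comm (suc n) (suc (suc n)) ⟩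
  suc (suc n) ℕ.* suc n ∎
  where open ≡.≡-Reasoning

countPairs-< : ∀ n → countPairs n _<?_ ≡ n ℕ.* (n ℕ.∸ 1) / 2
countPairs-< n = ≡.trans (≡.sym (m*n/n≡m _ 2)) (cong (_/ 2) (countPairs-<-*2 n))

-- Matchings between the two halves of [2n]

StrictlyIncreasing : (Fin n → ℕ) → Set
StrictlyIncreasing f = ∀ {i j} → i < j → f i ℕ.< f j

-- The values are n distinct integers in an interval of length n, so none can be skipped. The
-- induction treats `f ∘ suc` on the interval starting at k + 1; the value at `zero` is then
-- squeezed between k and k + 1.
increasing-bounded⇒shift : ∀ {n} k (f : Fin n → ℕ) → StrictlyIncreasing f →
  (∀ i → k ℕ.≤ f i) → (∀ i → f i ℕ.< k ℕ.+ n) → ∀ i → f i ≡ k ℕ.+ toℕ i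
increasing-bounded⇒shift {suc n} k f mono k≤f f<k+n = λ where
    zero    → ≡.trans f0≡k (≡.sym (ℕ.+-identityʳ k))
    (suc i) → ≡.trans (ih i) (≡.sym (ℕ.+-suc k (toℕ i)))
  where
  ih : ∀ i → f (suc i) ≡ suc k ℕ.+ toℕ i
  ih = increasing-bounded⇒shift (suc k) (f ∘ suc) (mono ∘ s<s)
    (λ i → ℕ.≤-<-trans (k≤f zero) (mono z<s))
    (λ i → subst (f (suc i) ℕ.<_) (ℕ.+-suc k n) (f<k+n (suc i)))

  -- If `zero` is the only argument, the upper bound on `f` suffices; otherwise `f zero` lies below
  -- the next value, which `ih` computes as k + 1. The equation n ≡ n′ allows this case split inside
  -- the local scope.
  f0<1+k : ∀ n′ → n ≡ n′ → f zero ℕ.< suc k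
  f0<1+k zero    refl = subst (f zero ℕ.<_) (ℕ.+-comm k 1) (f<k+n zero)
  f0<1+k (suc _) refl =
    subst (f zero ℕ.<_) (≡.trans (ih zero) (ℕ.+-identityʳ (suc k))) (mono z<s)

  f0≡k : f zero ≡ k
  f0≡k = ℕ.≤-antisym (ℕ.m<1+n⇒m≤n (f0<1+k n refl)) (k≤f zero)

-- The shift by k = 0. It forces the left endpoints of a matching across the halves to be all of the
-- left half, in order.
increasing⇒id : (f : Fin n → Fin n) → (∀ {i j} → i < j → f i < f j) → ∀ i → f i ≡ i
increasing⇒id f mono i = toℕ-injective
  (increasing-bounded⇒shift 0 (toℕ ∘ f) mono (λ _ → ℕ.z≤n) (toℕ<n ∘ f) i)

module _ {n : ℕ} where

  ↑ˡ-mono-< : {i j : Fin n} → i < j → i ↑ˡ n < j ↑ˡ n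
  ↑ˡ-mono-< {i} {j} = subst₂ ℕ._<_ (≡.sym (toℕ-↑ˡ i n)) (≡.sym (toℕ-↑ˡ j n))

  ↑ˡ-cancel-< : {i j : Fin n} → i ↑ˡ n < j ↑ˡ n → i < j
  ↑ˡ-cancel-< {i} {j} = subst₂ ℕ._<_ (toℕ-↑ˡ i n) (toℕ-↑ˡ j n)

  ↑ʳ-mono-< : {i j : Fin n} → i < j → n ↑ʳ i < n ↑ʳ j
  ↑ʳ-mono-< {i} {j} i<j =
    subst₂ ℕ._<_ (≡.sym (toℕ-↑ʳ n i)) (≡.sym (toℕ-↑ʳ n j)) (ℕ.+-monoʳ-< n i<j)

  ↑ʳ-cancel-< : {i j : Fin n} → n ↑ʳ i < n ↑ʳ j → i < j
  ↑ʳ-cancel-< {i} {j} lt =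
    ℕ.+-cancelˡ-< n _ _ (subst₂ ℕ._<_ (toℕ-↑ʳ n i) (toℕ-↑ʳ n j) lt)

  ↑ˡ<↑ʳ : (i j : Fin n) → i ↑ˡ n < n ↑ʳ j
  ↑ˡ<↑ʳ i j = subst₂ ℕ._<_ (≡.sym (toℕ-↑ˡ i n)) (≡.sym (toℕ-↑ʳ n j))
    (ℕ.<-≤-trans (toℕ<n i) (ℕ.m≤m+n n (toℕ j)))

  ↑ˡ⊎↑ʳ : (k : Fin (n ℕ.+ n)) → (∃ λ i → i ↑ˡ n ≡ k) ⊎ (∃ λ i → n ↑ʳ i ≡ k)
  ↑ˡ⊎↑ʳ k with splitAt n k in eq
  ... | inj₁ i = inj₁ (i , splitAt⁻¹-↑ˡ eq)
  ... | inj₂ i = inj₂ (i , splitAt⁻¹-↑ʳ eq)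

  matchingOf : Vec (Fin n) n → Pairs (n ℕ.+ n) n
  matchingOf σ = tabulate λ i → i ↑ˡ n , n ↑ʳ lookup σ i

  module _ (m : Pairs (n ℕ.+ n) n) where

    lookup-entries-↑ˡ : ∀ i → lookup (entries m) (i ↑ˡ n) ≡ fst m i
    lookup-entries-↑ˡ i = ≡.trans (Vec.lookup-++ˡ (Vec.map proj₁ m) _ i) (Vec.lookup-map i proj₁ m)

    lookup-entries-↑ʳ : ∀ i → lookup (entries m) (n ↑ʳ i) ≡ snd m i
    lookup-entries-↑ʳ i = ≡.trans (Vec.lookup-++ʳ (Vec.map proj₁ m) _ i) (Vec.lookup-map i proj₂ m)

  module _ (σ : Vec (Fin n) n) where

    fst-matchingOf : ∀ i → fst (matchingOf σ) i ≡ i ↑ˡ n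
    fst-matchingOf i = cong proj₁ (Vec.lookup∘tabulate _ i)

    snd-matchingOf : ∀ i → snd (matchingOf σ) i ≡ n ↑ʳ lookup σ i
    snd-matchingOf i = cong proj₂ (Vec.lookup∘tabulate _ i)

    fst-<⁻ : ∀ i j → fst (matchingOf σ) i < fst (matchingOf σ) j → i < j
    fst-<⁻ i j = ↑ˡ-cancel-< ∘ subst₂ _<_ (fst-matchingOf i) (fst-matchingOf j)

    fst-<⁺ : ∀ i j → i < j → fst (matchingOf σ) i < fst (matchingOf σ) j
    fst-<⁺ i j =
      subst₂ _<_ (≡.sym (fst-matchingOf i)) (≡.sym (fst-matchingOf j)) ∘ ↑ˡ-mono-<

    snd-<⁻ : ∀ i j → snd (matchingOf σ) i < snd (matchingOf σ) j → lookup σ i < lookup σ j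
    snd-<⁻ i j = ↑ʳ-cancel-< ∘ subst₂ _<_ (snd-matchingOf i) (snd-matchingOf j)

    snd-<⁺ : ∀ i j → lookup σ i < lookup σ j → snd (matchingOf σ) i < snd (matchingOf σ) j
    snd-<⁺ i j =
      subst₂ _<_ (≡.sym (snd-matchingOf i)) (≡.sym (snd-matchingOf j)) ∘ ↑ʳ-mono-<

    fst<snd : ∀ i j → fst (matchingOf σ) i < snd (matchingOf σ) j
    fst<snd i j =
      subst₂ _<_ (≡.sym (fst-matchingOf i)) (≡.sym (snd-matchingOf j)) (↑ˡ<↑ʳ i _)

  -- Keeps the list of images free of repetition, so that no permutation is lost when the Pfaffian
  -- is summed over matchings.
  matchingOf-injective : (σ τ : Vec (Fin n) n) → matchingOf σ ≡ matchingOf τ → σ ≡ τ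
  matchingOf-injective σ τ eq = begin
    σ                   ≡⟨ Vec.tabulate∘lookup σ ⟨
    tabulate (lookup σ) ≡⟨ Vec.tabulate-cong pointwise ⟩
    tabulate (lookup τ) ≡⟨ Vec.tabulate∘lookup τ ⟩
    τ                   ∎
    where
    open ≡.≡-Reasoning
    pointwise : ∀ i → lookup σ i ≡ lookup τ i
    pointwise i = ↑ʳ-injective n _ _
      (≡.trans (≡.sym (snd-matchingOf σ i))
        (≡.trans (cong (λ m → snd m i) eq) (snd-matchingOf τ i)))

  -- The map from positions to `entries` is the identity on the left half and σ on the right half,
  -- hence bijective because σ is.
  matchingOf-isPerfectMatching : (σ : Vec (Fin n) n) → IsBijection σ → IsPerfectMatching (matchingOf σ)
  matchingOf-isPerfectMatching σ (σ-inj , σ-surj) = record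
    { ordered   = λ i → fst<snd σ i i
    ; sorted    = fst-<⁺ σ
    ; partition = (λ {k} {l} → injective k l) , surjective
    }
    where
    e : Fin (n ℕ.+ n) → Fin (n ℕ.+ n)
    e = lookup (entries (matchingOf σ))

    eˡ : ∀ i → e (i ↑ˡ n) ≡ i ↑ˡ n
    eˡ i = ≡.trans (lookup-entries-↑ˡ (matchingOf σ) i) (fst-matchingOf σ i)

    eʳ : ∀ i → e (n ↑ʳ i) ≡ n ↑ʳ lookup σ i
    eʳ i = ≡.trans (lookup-entries-↑ʳ (matchingOf σ) i) (snd-matchingOf σ i)

    injective : ∀ k l → e k ≡ e l → k ≡ l
    injective k l eq with ↑ˡ⊎↑ʳ k | ↑ˡ⊎↑ʳ l
    ... | inj₁ (i , refl) | inj₁ (j , refl) = subst₂ _≡_ (eˡ i) (eˡ j) eq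
    ... | inj₁ (i , refl) | inj₂ (j , refl) =
      contradiction (subst₂ _≡_ (eˡ i) (eʳ j) eq) (<⇒≢ (↑ˡ<↑ʳ i _))
    ... | inj₂ (i , refl) | inj₁ (j , refl) =
      contradiction (subst₂ _≡_ (eˡ j) (eʳ i) (≡.sym eq)) (<⇒≢ (↑ˡ<↑ʳ j _))
    ... | inj₂ (i , refl) | inj₂ (j , refl) =
      cong (n ↑ʳ_) (σ-inj (↑ʳ-injective n _ _ (subst₂ _≡_ (eʳ i) (eʳ j) eq)))

    surjective : ∀ y → ∃ λ k → ∀ {l} → l ≡ k → e l ≡ y
    surjective y with ↑ˡ⊎↑ʳ y
    ... | inj₁ (i , refl) = i ↑ˡ n , λ { refl → eˡ i }
    ... | inj₂ (i , refl) with σ-surj i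
    ...   | j , σj≡i = n ↑ʳ j , λ { refl → ≡.trans (eʳ j) (cong (n ↑ʳ_) (σj≡i refl)) }

  -- `sorted` makes the left endpoints increase, so the i-th one is i itself, and σ is read off from
  -- the right endpoints. Bijectivity of σ is that of `entries` restricted to the right half.
  bipartite⇒matchingOf : {m : Pairs (n ℕ.+ n) n} → IsPerfectMatching m →
    (∀ i → ∃₂ λ x y → fst m i ≡ x ↑ˡ n × snd m i ≡ n ↑ʳ y) →
    ∃ λ σ → IsBijection σ × m ≡ matchingOf σ
  bipartite⇒matchingOf {m} M bip = σ , ((λ {i} {j} → injective i j) , surjective) , m≡
    where
    open IsPerfectMatching M

    left right : Fin n → Fin n
    left  i = proj₁ (bip i)
    right i = proj₁ (proj₂ (bip i))

    σ : Vec (Fin n) n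
    σ = tabulate right

    fst≡left : ∀ i → fst m i ≡ left i ↑ˡ n
    fst≡left i = proj₁ (proj₂ (proj₂ (bip i)))

    snd≡σ : ∀ i → snd m i ≡ n ↑ʳ lookup σ i
    snd≡σ i = ≡.trans (proj₂ (proj₂ (proj₂ (bip i))))
      (cong (n ↑ʳ_) (≡.sym (Vec.lookup∘tabulate right i)))

    left≡id : ∀ i → left i ≡ i
    left≡id = increasing⇒id left λ {i} {j} i<j →
      ↑ˡ-cancel-< (subst₂ _<_ (fst≡left i) (fst≡left j) (sorted i j i<j))

    fst≡ : ∀ i → fst m i ≡ i ↑ˡ n
    fst≡ i = ≡.trans (fst≡left i) (cong (_↑ˡ n) (left≡id i))

    m≡ : m ≡ matchingOf σ
    m≡ = ≡.trans (≡.sym (Vec.tabulate∘lookup m))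
      (Vec.tabulate-cong λ i → cong₂ _,_ (fst≡ i) (snd≡σ i))

    entriesʳ : ∀ i → lookup (entries m) (n ↑ʳ i) ≡ n ↑ʳ lookup σ i
    entriesʳ i = ≡.trans (lookup-entries-↑ʳ m i) (snd≡σ i)

    injective : ∀ i j → lookup σ i ≡ lookup σ j → i ≡ j
    injective i j eq = ↑ʳ-injective n i j (proj₁ partition
      (≡.trans (entriesʳ i) (≡.trans (cong (n ↑ʳ_) eq) (≡.sym (entriesʳ j)))))

    surjective : ∀ y → ∃ λ i → ∀ {j} → j ≡ i → lookup σ j ≡ y
    surjective y with proj₂ partition (n ↑ʳ y)
    ... | k , hit with ↑ˡ⊎↑ʳ k
    -- A position in the left half holds an element of the left half, so the preimage of `n ↑ʳ y`
    -- must be a position in the right half.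
    ...   | inj₁ (i , refl) = contradiction
              (≡.trans (≡.sym (fst≡ i)) (≡.trans (≡.sym (lookup-entries-↑ˡ m i)) (hit refl)))
              (<⇒≢ (↑ˡ<↑ʳ i y))
    ...   | inj₂ (i , refl) =
              i , λ { refl → ↑ʳ-injective n _ _ (≡.trans (≡.sym (entriesʳ i)) (hit refl)) }

  module _ (σ : Vec (Fin n) n) where

    private
      m : Pairs (n ℕ.+ n) n
      m = matchingOf σ

    -- Every first component precedes every second one, so the middle inequality of a nesting is
    -- automatic and the outer two describe an inversion.
    nest-matchingOf : nest m ≡ inversions σ
    nest-matchingOf = cong length (filter-≐ _ _
      ( (λ { {i , j} (i<j , _ , gt) → fst-<⁻ σ i j i<j , snd-<⁻ σ j i gt })
      , (λ { {i , j} (i<j , gt) → fst-<⁺ σ i j i<j , fst<snd σ j j , snd-<⁺ σ j i gt }))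
      (cartesianProduct (allFin n) (allFin n)))

    -- Again the middle inequalities are automatic. For i < j the values σ i and σ j differ by
    -- injectivity, and their order decides between crossing and nesting; so each pair i < j is
    -- counted exactly once.
    cross+nest-matchingOf : IsBijection σ → cross m ℕ.+ nest m ≡ n ℕ.* (n ℕ.∸ 1) / 2
    cross+nest-matchingOf (σ-inj , _) = ≡.trans
      (length-filter-⊎ _ _ _
        (λ { {i , j} (i<j , _) → fst-<⁻ σ i j i<j })
        (λ { {i , j} (i<j , _) → fst-<⁻ σ i j i<j })
        (λ { {i , j} i<j → split i j i<j })
        (λ { {i , j} (_ , _ , lt) (_ , _ , gt) → ℕ.<-asym lt gt })
        (cartesianProduct (allFin n) (allFin n)))
      (countPairs-< n)
      where
      split : ∀ i j → i < j →
        (fst m i < fst m j × fst m j < snd m i × snd m i < snd m j) ⊎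
        (fst m i < fst m j × fst m j < snd m j × snd m j < snd m i)
      split i j i<j with <-cmp (lookup σ i) (lookup σ j)
      ... | tri< lt _ _ = inj₁ (fst-<⁺ σ i j i<j , fst<snd σ j i , snd-<⁺ σ i j lt)
      ... | tri≈ _ eq _ = contradiction (σ-inj eq) (<⇒≢ i<j)
      ... | tri> _ _ gt = inj₂ (fst-<⁺ σ i j i<j , fst<snd σ j j , snd-<⁺ σ j i gt)

-- Finite sums and powers of -1 in a commutative ring

module _ {c ℓ} (R : CommutativeRing c ℓ) where

  open CommutativeRing R renaming (refl to ≈-refl)
  open CommutativeExp commutativeSemiring using (^-distrib-*)
  open Exp semiring using (_^_; ^-congˡ; ^-congʳ; ^-homo-*)
  open RingProperties ring using (-1*x≈-x; -‿involutive)
  open MonoidSum *-monoid using () renaming (sum-cong-≋ to ∏-cong)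
  open SetoidReasoning setoid

  ∑-cong : ∀ (xs : List A) {f g : A → Carrier} →
    (∀ {x} → x ∈ xs → f x ≈ g x) → ∑ R xs f ≈ ∑ R xs g
  ∑-cong []       f≈g = ≈-refl
  ∑-cong (x ∷ xs) f≈g = +-cong (f≈g (here refl)) (∑-cong xs (f≈g ∘ there))

  ∑-map : ∀ (h : A → B) xs {f} → ∑ R (map h xs) f ≈ ∑ R xs (f ∘ h)
  ∑-map h []       = ≈-refl
  ∑-map h (x ∷ xs) = +-congˡ (∑-map h xs)

  ∑-distribˡ : ∀ k (xs : List A) {f} → ∑ R xs (λ x → k * f x) ≈ k * ∑ R xs f
  ∑-distribˡ k []       = sym (zeroʳ k)
  ∑-distribˡ k (x ∷ xs) = trans (+-congˡ (∑-distribˡ k xs)) (sym (distribˡ k _ _))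

  ∑-↭ : {xs ys : List A} (f : A → Carrier) → xs ↭ ys → ∑ R xs f ≈ ∑ R ys f
  ∑-↭ f xs↭ys = PermutationProperties.foldr-commMonoid setoid +-isCommutativeMonoid
    (↭⇒↭ₛ′ isEquivalence (map⁺ f xs↭ys))

  ∑-filter : {P : Pred A p} (P? : Decidable P) → ∀ xs {f} →
    (∀ {x} → x ∈ xs → ¬ P x → f x ≈ 0#) → ∑ R (filter P? xs) f ≈ ∑ R xs f
  ∑-filter P? []       f≈0 = ≈-refl
  ∑-filter P? (x ∷ xs) f≈0 with P? x
  ... | yes _ = +-congˡ (∑-filter P? xs (f≈0 ∘ there))
  ... | no ¬p = trans (∑-filter P? xs (f≈0 ∘ there))
                      (trans (sym (+-identityˡ _)) (+-congʳ (sym (f≈0 (here refl) ¬p))))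

  -- Filtering `xs` by membership in `ys` discards only vanishing terms. What is left has the same
  -- elements as `ys`, both without repetition, so it is a rearrangement of `ys`.
  ∑-restrict : DecidableEquality A → {xs ys : List A} {f : A → Carrier} →
    Unique xs → Unique ys → ys ⊆ xs → (∀ {x} → x ∈ xs → x ∉ ys → f x ≈ 0#) →
    ∑ R xs f ≈ ∑ R ys f
  ∑-restrict _≟_ {xs} {ys} {f} xs! ys! ys⊆xs f≈0 = trans
    (sym (∑-filter ∈ys? xs f≈0))
    (∑-↭ f (unique-set⇒↭ (Unique.filter⁺ ∈ys? xs!) ys!
      (proj₂ ∘ ∈-filter⁻ ∈ys? {xs = xs})
      (λ y∈ys → ∈-filter⁺ ∈ys? (ys⊆xs y∈ys) y∈ys)))
    where
    ∈ys? : Decidable (_∈ ys)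
    ∈ys? x = _∈?_ _≟_ x ys

  ∏-zero : (f : F.Vector Carrier n) → ∀ i → f i ≈ 0# → ∏ R f ≈ 0#
  ∏-zero f zero    fi≈0 = trans (*-congʳ fi≈0) (zeroˡ _)
  ∏-zero f (suc i) fi≈0 = trans (*-congˡ (∏-zero (f ∘ suc) i fi≈0)) (zeroʳ _)

  1^n≈1 : ∀ k → 1# ^ k ≈ 1#
  1^n≈1 zero    = ≈-refl
  1^n≈1 (suc k) = trans (*-identityˡ _) (1^n≈1 k)

  -1*-1≈1 : - 1# * - 1# ≈ 1#
  -1*-1≈1 = trans (-1*x≈-x (- 1#)) (-‿involutive 1#)

  neg-^ : ∀ x k → (- x) ^ k ≈ (- 1#) ^ k * x ^ k
  neg-^ x k = trans (^-congˡ k (sym (-1*x≈-x x))) (^-distrib-* (- 1#) x k)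

  [-1]^k*[-1]^k≈1 : ∀ k → (- 1#) ^ k * (- 1#) ^ k ≈ 1#
  [-1]^k*[-1]^k≈1 k = begin
    (- 1#) ^ k * (- 1#) ^ k ≈⟨ ^-distrib-* (- 1#) (- 1#) k ⟨
    (- 1# * - 1#) ^ k       ≈⟨ ^-congˡ k -1*-1≈1 ⟩
    1# ^ k                  ≈⟨ 1^n≈1 k ⟩
    1#                      ∎

  -- Inserts the square of (-1)^l, which is 1. With k = cross and l = nest, the sign of a matching
  -- becomes a sign common to all σ times the sign of σ.
  [-1]^k≈[-1]^[k+l]*[-1]^l : ∀ k l → (- 1#) ^ k ≈ (- 1#) ^ (k ℕ.+ l) * (- 1#) ^ l
  [-1]^k≈[-1]^[k+l]*[-1]^l k l = begin
    (- 1#) ^ k                                ≈⟨ *-identityʳ _ ⟨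
    (- 1#) ^ k * 1#                           ≈⟨ *-congˡ ([-1]^k*[-1]^k≈1 l) ⟨
    (- 1#) ^ k * ((- 1#) ^ l * (- 1#) ^ l)    ≈⟨ *-assoc _ _ _ ⟨
    (- 1#) ^ k * (- 1#) ^ l * (- 1#) ^ l      ≈⟨ *-congʳ (^-homo-* (- 1#) k l) ⟨
    (- 1#) ^ (k ℕ.+ l) * (- 1#) ^ l           ∎

  -- The Pfaffian of the skew block matrix

  module _ (lam : Carrier) {n : ℕ} (A : Matrix R n n) where

    private
      S : Matrix R (n ℕ.+ n) (n ℕ.+ n)
      S = skewBlock R n A

      term : Pairs (n ℕ.+ n) n → Carrier
      term m = (- 1#) ^ cross m * lam ^ (cross m ℕ.+ nest m) * ∏ R λ i → S (fst m i) (snd m i)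

    skewBlock-↑ˡ-↑ˡ : ∀ i j → S (i ↑ˡ n) (j ↑ˡ n) ≡ 0#
    skewBlock-↑ˡ-↑ˡ i j rewrite splitAt-↑ˡ n i n | splitAt-↑ˡ n j n = refl

    skewBlock-↑ˡ-↑ʳ : ∀ i j → S (i ↑ˡ n) (n ↑ʳ j) ≡ A i j
    skewBlock-↑ˡ-↑ʳ i j rewrite splitAt-↑ˡ n i n | splitAt-↑ʳ n n j = refl

    skewBlock-↑ʳ-↑ʳ : ∀ i j → S (n ↑ʳ i) (n ↑ʳ j) ≡ 0#
    skewBlock-↑ʳ-↑ʳ i j rewrite splitAt-↑ʳ n n i | splitAt-↑ʳ n n j = refl

    -- The order k < l excludes the lower left block, and both diagonal blocks are zero, which
    -- leaves the block `A`.
    skewBlock-above-diagonal : ∀ k l → k < l →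
      (∃₂ λ x y → k ≡ x ↑ˡ n × l ≡ n ↑ʳ y) ⊎ S k l ≈ 0#
    skewBlock-above-diagonal k l k<l with ↑ˡ⊎↑ʳ {n} k | ↑ˡ⊎↑ʳ {n} l
    ... | inj₁ (i , refl) | inj₁ (j , refl) = inj₂ (reflexive (skewBlock-↑ˡ-↑ˡ i j))
    ... | inj₁ (i , refl) | inj₂ (j , refl) = inj₁ (i , j , refl , refl)
    ... | inj₂ (i , refl) | inj₁ (j , refl) = contradiction (↑ˡ<↑ʳ j i) (ℕ.<-asym k<l)
    ... | inj₂ (i , refl) | inj₂ (j , refl) = inj₂ (reflexive (skewBlock-↑ʳ-↑ʳ i j))

    term-matchingOf : ∀ σ → IsBijection σ →
      term (matchingOf σ) ≈
        (- lam) ^ (n ℕ.* (n ℕ.∸ 1) / 2) * ((- 1#) ^ inversions σ * ∏ R λ i → A i (lookup σ i))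
    term-matchingOf σ bij = begin
      (- 1#) ^ cr * lam ^ (cr ℕ.+ ne) * (∏ R λ i → S (fst m i) (snd m i))
        ≈⟨ *-cong (*-congʳ ([-1]^k≈[-1]^[k+l]*[-1]^l cr ne)) (∏-cong entry) ⟩
      (- 1#) ^ (cr ℕ.+ ne) * (- 1#) ^ ne * lam ^ (cr ℕ.+ ne) * prod
        ≈⟨ *-congʳ (*-assoc _ _ _) ⟩
      (- 1#) ^ (cr ℕ.+ ne) * ((- 1#) ^ ne * lam ^ (cr ℕ.+ ne)) * prod
        ≈⟨ *-congʳ (*-congˡ (*-comm _ _)) ⟩
      (- 1#) ^ (cr ℕ.+ ne) * (lam ^ (cr ℕ.+ ne) * (- 1#) ^ ne) * prod
        ≈⟨ *-congʳ (*-assoc _ _ _) ⟨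
      (- 1#) ^ (cr ℕ.+ ne) * lam ^ (cr ℕ.+ ne) * (- 1#) ^ ne * prod
        ≈⟨ *-assoc _ _ _ ⟩
      (- 1#) ^ (cr ℕ.+ ne) * lam ^ (cr ℕ.+ ne) * ((- 1#) ^ ne * prod)
        -- The preceding steps only bring the two powers with exponent `cr ℕ.+ ne` together; here
        -- they merge into one power of `- lam`.
        ≈⟨ *-congʳ (neg-^ lam (cr ℕ.+ ne)) ⟨
      (- lam) ^ (cr ℕ.+ ne) * ((- 1#) ^ ne * prod)
        -- Bijectivity of σ enters here: it makes the exponent the same for all permutations.
        ≈⟨ *-cong (^-congʳ (- lam) (cross+nest-matchingOf σ bij))
                  (*-congʳ (^-congʳ (- 1#) (nest-matchingOf σ))) ⟩
      (- lam) ^ (n ℕ.* (n ℕ.∸ 1) / 2) * ((- 1#) ^ inversions σ * prod) ∎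
      where
      m : Pairs (n ℕ.+ n) n
      m = matchingOf σ

      cr ne : ℕ
      cr = cross m
      ne = nest m

      prod : Carrier
      prod = ∏ R λ i → A i (lookup σ i)

      entry : ∀ i → S (fst m i) (snd m i) ≈ A i (lookup σ i)
      entry i = reflexive
        (≡.trans (cong₂ S (fst-matchingOf σ i) (snd-matchingOf σ i)) (skewBlock-↑ˡ-↑ʳ i _))

    -- Either some pair meets a zero entry, which kills the product, or all pairs go across, and
    -- then the matching comes from a permutation, against the assumption.
    term-vanishes : ∀ {m} → IsPerfectMatching m → m ∉ map matchingOf (permutations n) → term m ≈ 0#
    term-vanishes {m} M m∉
      with ∀⊎∃ (λ i → skewBlock-above-diagonal _ _ (IsPerfectMatching.ordered M i))
    ... | inj₂ (i , Si≈0) = trans (*-congˡ (∏-zero _ i Si≈0)) (zeroʳ _)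
    ... | inj₁ bip with bipartite⇒matchingOf M bip
    ...   | σ , bij , refl = contradiction (∈-map⁺ matchingOf (∈-permutations⁺ σ bij)) m∉

    Pf-skewBlock : Pf R lam n S ≈ (- lam) ^ (n ℕ.* (n ℕ.∸ 1) / 2) * det R n A
    Pf-skewBlock = begin
      ∑ R (perfectMatchings n) term
        -- Matchings that do not come from a permutation contribute zero, so the sum shrinks to the
        -- image of `matchingOf`.
        ≈⟨ ∑-restrict (Vec.≡-dec (Product.≡-dec _≟_ _≟_)) (perfectMatchings-unique n)
             (Unique.map⁺ (matchingOf-injective _ _) (permutations-unique n)) image⊆
             (term-vanishes ∘ ∈-perfectMatchings⁻) ⟩
      ∑ R (map matchingOf (permutations n)) term
        ≈⟨ ∑-map matchingOf (permutations n) ⟩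
      ∑ R (permutations n) (term ∘ matchingOf)
        ≈⟨ ∑-cong (permutations n) (λ {σ} σ∈ → term-matchingOf σ (∈-permutations⁻ σ σ∈)) ⟩
      -- The underscore is the summand of `det`; the power of `- lam` is independent of σ and leaves
      -- the sum.
      ∑ R (permutations n) (λ σ → (- lam) ^ (n ℕ.* (n ℕ.∸ 1) / 2) * _)
        ≈⟨ ∑-distribˡ _ (permutations n) ⟩
      (- lam) ^ (n ℕ.* (n ℕ.∸ 1) / 2) * det R n A ∎
      where
      image⊆ : map matchingOf (permutations n) ⊆ perfectMatchings n
      image⊆ m∈ with ∈-map⁻ matchingOf m∈
      ... | σ , σ∈ , refl = ∈-perfectMatchings⁺ (matchingOf-isPerfectMatching σ (∈-permutations⁻ σ σ∈))

proposition4 : ∀ {c ℓ} (R : CommutativeRing c ℓ) →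
    let open CommutativeRing R
        open Exp semiring using (_^_)
    in (lam : Carrier) (n : ℕ) (A : Matrix R n n) →
       Pf R lam n (skewBlock R n A)
         ≈ (- lam) ^ (n ℕ.* (n ℕ.∸ 1) / 2) * det R n A
proposition4 R lam n A = Pf-skewBlock R lam A
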